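{- Consider the 3-person non-initialized game $(\mathcal{G}_3,u)$ under the Markov realization, where the payoff $u$ satisfies $$u_1(a_2)>u_1(a_1)>u_1(a_3)>u_1(c),\quad u_2(a_3)>u_2(a_2)>u_2(a_1)>u_2(c),\quad u_3(a_1)>u_3(a_3)>u_3(a_2)>u_3(c).$$ Set $$\mu_1=\frac{u_1(a_2)-u_1(a_1)}{u_1(a_1)-u_1(a_3)},\quad \mu_2=\frac{u_2(a_3)-u_2(a_2)}{u_2(a_2)-u_2(a_1)},\quad \mu_3=\frac{u_3(a_1)-u_3(a_3)}{u_3(a_3)-u_3(a_2)}.$$ If $\mu_1\mu_2\mu_3\ge 1$, then $(\mathcal{G}_3,u)$ has no uniform Nash equilibrium in mixed strategies. If $\mu_1\mu_2\mu_3<1$, then $(\mathcal{G}_3,u)$ has a unique uniform Nash equilibrium in mixed strategies, and it is determined by the probabilities $$p_1=\frac{\mu_3(1+\mu_1+\mu_1\mu_2)}{1+\mu_3+\mu_3\mu_1},\quad p_2=\frac{\mu_1(1+\mu_2+\mu_2\mu_3)}{1+\mu_1+\mu_1\mu_2},\quad p_3=\frac{\mu_2(1+\mu_3+\mu_3\mu_1)}{1+\mu_2+\mu_2\mu_3}.$$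
   Context: Game structure $\mathcal{G}_3$: the directed graph has non-terminal positions $v_1,v_2,v_3$, terminal positions $a_1,a_2,a_3$, and arcs $(v_1,v_2),(v_2,v_3),(v_3,v_1)$ (the cycle) and $(v_i,a_i)$, $i=1,2,3$. Player $i\in\{1,2,3\}$ controls $v_i$. The outcomes are $a_1,a_2,a_3$ (termination there) and $c$ (infinite play). A payoff is $u:\{1,2,3\}\times\{a_1,a_2,a_3,c\}\to\mathbb{R}$, written $u_i(a)$. A mixed strategy of player $i$ is a number $p_i\in[0,1]$: the probability of following the cycle from $v_i$; with probability $1-p_i$ the player moves to $a_i$. Under the Markov realization the move is drawn afresh and independently each time a position is visited. Thus if $p_1=p_2=p_3=1$ the outcome is $c$ with probability 1 from every initial position; otherwise, with $\Delta=1-p_1p_2p_3$, the distribution on $(a_1,a_2,a_3,c)$ is $\frac1\Delta(1-p_1,\;p_1(1-p_2),\;p_1p_2(1-p_3),\;0)$ for initial position $v_1$, $\frac1\Delta(p_2p_3(1-p_1),\;1-p_2,\;p_2(1-p_3),\;0)$ for $v_2$, $\frac1\Delta(p_3(1-p_1),\;p_1p_3(1-p_2),\;1-p_3,\;0)$ for $v_3$. Player $i$'s expected payoff is the corresponding expectation of $u_i$. A triple $(p_1,p_2,p_3)\in[0,1]^3$ is a uniform Nash equilibrium (UNE) if for each initial position $v_j$, $j=1,2,3$, no player can strictly increase his expected payoff by changing only his own $p_i\in[0,1]$. -}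

module Defs where

open import Algebra.Bundles using (CommutativeRing)
open import Data.Bool.Base using (if_then_else_)
open import Data.Fin.Base using (Fin; zero; suc)
open import Data.Fin.Properties using (all?)
open import Data.Product.Base using (_×_)
open import Data.Vec.Functional using (Vector; updateAt)
open import Function.Base using (const)
import Level
open import Level using (_⊔_)
open import Relation.Binary.Core using (Rel)
open import Relation.Binary.Structures using (IsStrictTotalOrder)
open import Relation.Nullary using (¬_)
open import Relation.Nullary.Decidable using (does)
import Relation.Binary.Construct.StrictToNonStrict as StrictToNonStrict

-- Linearly ordered fields, the classical real numbers among them.  The
-- inverse is a total operation whose value at 0# is left unspecified; every
-- divisor below is nonzero wherever it matters (Δ p for probabilities not all
-- 1#, and the others, which are positive under the ranking of the outcomes).
record OrderedField c ℓ₁ ℓ₂ : Set (Level.suc (c ⊔ ℓ₁ ⊔ ℓ₂)) where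
  infix  4 _<_
  infix  8 _⁻¹
  infixl 7 _/_
  field
    commutativeRing : CommutativeRing c ℓ₁

  open CommutativeRing commutativeRing public

  field
    _<_                : Rel Carrier ℓ₂
    isStrictTotalOrder : IsStrictTotalOrder _≈_ _<_
    0≉1                : ¬ (0# ≈ 1#)
    +-monoˡ-<          : ∀ z {x y} → x < y → x + z < y + z
    *-pos              : ∀ {x y} → 0# < x → 0# < y → 0# < x * y
    _⁻¹                : Carrier → Carrier
    ⁻¹-cong            : ∀ {x y} → x ≈ y → x ⁻¹ ≈ y ⁻¹
    ⁻¹-inverseʳ        : ∀ x → ¬ (x ≈ 0#) → x * x ⁻¹ ≈ 1#

  open IsStrictTotalOrder isStrictTotalOrder public
    using (compare; _≟_; _<?_)
  open StrictToNonStrict _≈_ _<_ public using (_≤_)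

  _/_ : Carrier → Carrier → Carrier
  x / y = x * y ⁻¹

-- Player i controls the non-terminal position vᵢ, so the same index names both.
Player Position : Set
Player   = Fin 3
Position = Fin 3

pattern ① = zero
pattern ② = suc zero
pattern ③ = suc (suc zero)

data Outcome : Set where
  a : Position → Outcome   -- termination at aᵢ
  c : Outcome              -- infinite play

module Game {k ℓ₁ ℓ₂} (K : OrderedField k ℓ₁ ℓ₂) where
  open OrderedField K

  Payoff : Set k
  Payoff = Player → Outcome → Carrier

  -- Component i is the probability that player i follows the cycle from vᵢ;
  -- with the complementary probability the move is to aᵢ.
  Profile : Set k
  Profile = Vector Carrier 3

  IsProbability : Carrier → Set (ℓ₁ ⊔ ℓ₂)
  IsProbability x = (0# ≤ x) × (x ≤ 1#)

  Δ : Profile → Carrier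
  Δ p = 1# - p ① * p ② * p ③

  -- The probability that a play from the given position reaches the outcome
  -- before completing a full turn of the cycle.
  firstTurn : Profile → Position → Outcome → Carrier
  firstTurn p _ c     = 0#
  firstTurn p ① (a ①) = 1# - p ①
  firstTurn p ① (a ②) = p ① * (1# - p ②)
  firstTurn p ① (a ③) = p ① * p ② * (1# - p ③)
  firstTurn p ② (a ①) = p ② * p ③ * (1# - p ①)
  firstTurn p ② (a ②) = 1# - p ②
  firstTurn p ② (a ③) = p ② * (1# - p ③)
  firstTurn p ③ (a ①) = p ③ * (1# - p ①)
  firstTurn p ③ (a ②) = p ① * p ③ * (1# - p ②)
  firstTurn p ③ (a ③) = 1# - p ③

  surelyInfinite : Outcome → Carrier
  surelyInfinite (a _) = 0#
  surelyInfinite c     = 1#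

  -- The outcome distribution under the Markov realization.  For probabilities
  -- that are not all 1#, Δ p is positive, and summing the geometric series
  -- over the number of full turns gives the factor 1 / Δ p.
  distribution : Profile → Position → Outcome → Carrier
  distribution p v x =
    if does (all? (λ i → p i ≟ 1#))
    then surelyInfinite x
    else firstTurn p v x / Δ p

  module _ (u : Payoff) where

    expectedPayoff : Profile → Position → Player → Carrier
    expectedPayoff p v i =
      distribution p v (a ①) * u i (a ①) +
      distribution p v (a ②) * u i (a ②) +
      distribution p v (a ③) * u i (a ③) +
      distribution p v c     * u i c

    IsUNE : Profile → Set (k ⊔ ℓ₁ ⊔ ℓ₂)
    IsUNE p =
      (∀ i → IsProbability (p i)) ×
      (∀ (v : Position) (i : Player) (q : Carrier) → IsProbability q →
       ¬ (expectedPayoff p v i < expectedPayoff (updateAt p i (const q)) v i))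

    μ₁ μ₂ μ₃ : Carrier
    μ₁ = (u ① (a ②) - u ① (a ①)) / (u ① (a ①) - u ① (a ③))
    μ₂ = (u ② (a ③) - u ② (a ②)) / (u ② (a ②) - u ② (a ①))
    μ₃ = (u ③ (a ①) - u ③ (a ③)) / (u ③ (a ③) - u ③ (a ②))

    equilibrium : Profile
    equilibrium ① = (μ₃ * (1# + μ₁ + μ₁ * μ₂)) / (1# + μ₃ + μ₃ * μ₁)
    equilibrium ② = (μ₁ * (1# + μ₂ + μ₂ * μ₃)) / (1# + μ₁ + μ₁ * μ₂)
    equilibrium ③ = (μ₂ * (1# + μ₃ + μ₃ * μ₁)) / (1# + μ₂ + μ₂ * μ₃)

{-# OPTIONS --safe #-}

-- Moving pᵢ to q changes the expected payoff of player i, from every initial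
-- position, by a nonnegative multiple of
--   (q - pᵢ) (μᵢ (1 - pᵢ₊₁) - pᵢ₊₁ (1 - pᵢ₊₂)),
-- whose second factor, the slope, does not involve pᵢ.  So a best reply is 0 or
-- 1 unless the slope vanishes.  Following these implications around the cycle
-- excludes 0 and 1 for every pᵢ, hence an equilibrium solves
--   μᵢ (1 - pᵢ₊₁) = pᵢ₊₁ (1 - pᵢ₊₂),   i mod 3.
-- The product of the three equations is μ₁μ₂μ₃ = p₁p₂p₃ < 1, and with this
-- value of p₁p₂p₃ they become linear and determine each pᵢ.  Conversely, where
-- all slopes vanish no deviation changes any payoff.
module Submission where

open import Algebra.Bundles using (CommutativeRing)
open import Algebra.Solver.Ring.AlmostCommutativeRing
  using (fromCommutativeRing; _-Raw-AlmostCommutative⟶_)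
open import Data.Bool.Base using (if_then_else_)
open import Data.Fin.Base using (zero; suc)
open import Data.Fin.Patterns using (0F; 1F; 2F; 3F; 4F; 5F; 6F)
open import Data.Fin.Properties using (all?; ¬∀⟶∃¬)
open import Data.Integer.Base as ℤ using (ℤ; +_; -[1+_]; _⊖_; _◃_; 0ℤ; 1ℤ)
import Data.Integer.Properties as ℤ
open import Data.Maybe.Base using (Maybe; map)
open import Data.Nat.Base as ℕ using (zero; suc)
import Data.Nat.Properties as ℕ
open import Data.Product.Base using (_×_; _,_; proj₁; proj₂; ∃)
open import Data.Sign.Base as Sign using (Sign)
open import Data.Sum.Base using (inj₁; inj₂)
open import Data.Vec.Base using (Vec; _∷_; [])
open import Data.Vec.Functional using (Vector; tail; updateAt)
open import Data.Vec.Functional.Properties using (updateAt-updates; updateAt-minimal)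
open import Function.Base using (const; _∘_)
open import Level using (_⊔_)
open import Relation.Binary.Definitions using (tri<; tri≈; tri>)
open import Relation.Binary.PropositionalEquality.Core as ≡ using (_≡_; _≢_)
import Relation.Binary.Reasoning.Setoid as ≈-Reasoning
open import Relation.Binary.Structures using (IsStrictTotalOrder)
open import Relation.Nullary using (¬_; contradiction; yes; no)
open import Relation.Nullary.Decidable using (dec⇒maybe; dec-true; dec-false)
open import Defs

-- Ring identities with integer coefficients.

-- Over an abstract ring the solver can only cancel terms if its coefficients
-- live in a ring whose equality computes, such as ℤ.
module IntegerCoefficients {r₁ r₂} (R : CommutativeRing r₁ r₂) where
  open CommutativeRing R
  open import Algebra.Properties.Ring ring using (-‿distribˡ-*; -‿distribʳ-*)
  open import Algebra.Properties.AbelianGroup +-abelianGroup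
    using (ε⁻¹≈ε; ⁻¹-involutive; ⁻¹-∙-comm)
  open import Algebra.Properties.CommutativeSemigroup +-commutativeSemigroup
    using (interchange)
  -- With these multiples `1 · 1#` reduces to `1#`, so `con 1ℤ` denotes `1#` itself in solver goals.
  open import Algebra.Properties.Semiring.Mult.TCOptimised semiring
    renaming (_×_ to _·_)
  open ≈-Reasoning setoid

  private
    fromℤ : ℤ → Carrier
    fromℤ (+ n)    = n · 1#
    fromℤ -[1+ n ] = - (suc n · 1#)

    fromℤ-⊖ : ∀ m n → fromℤ (m ⊖ n) ≈ m · 1# - n · 1#
    fromℤ-⊖ zero    zero    = sym (-‿inverseʳ 0#)
    fromℤ-⊖ zero    (suc n) = sym (+-identityˡ _)
    fromℤ-⊖ (suc m) zero    = sym (trans (+-congˡ ε⁻¹≈ε) (+-identityʳ _))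
    fromℤ-⊖ (suc m) (suc n) = begin
      fromℤ (suc m ⊖ suc n)                ≡⟨ ≡.cong fromℤ (ℤ.[1+m]⊖[1+n]≡m⊖n m n) ⟩
      fromℤ (m ⊖ n)                        ≈⟨ fromℤ-⊖ m n ⟩
      m · 1# - n · 1#                      ≈⟨ +-identityˡ _ ⟨
      0# + (m · 1# - n · 1#)               ≈⟨ +-congʳ (-‿inverseʳ 1#) ⟨
      (1# - 1#) + (m · 1# - n · 1#)        ≈⟨ interchange _ _ _ _ ⟩
      (1# + m · 1#) + (- 1# - n · 1#)      ≈⟨ +-congˡ (⁻¹-∙-comm _ _) ⟩
      (1# + m · 1#) - (1# + n · 1#)        ≈⟨ +-cong (1+× m 1#) (-‿cong (1+× n 1#)) ⟨
      suc m · 1# - suc n · 1#              ∎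

    -- A product of integers is a sign attached by `◃` to a product of magnitudes, and `◃` is stuck
    -- until the magnitude is known to be zero or a successor.
    fromℤ-+◃ : ∀ n → fromℤ (Sign.+ ◃ n) ≈ n · 1#
    fromℤ-+◃ zero    = refl
    fromℤ-+◃ (suc n) = refl

    fromℤ--◃ : ∀ n → fromℤ (Sign.- ◃ n) ≈ - (n · 1#)
    fromℤ--◃ zero    = sym ε⁻¹≈ε
    fromℤ--◃ (suc n) = refl

    fromℤ-+ : ∀ i j → fromℤ (i ℤ.+ j) ≈ fromℤ i + fromℤ j
    fromℤ-+ (+ m)    (+ n)    = ×-homo-+ 1# m n
    fromℤ-+ (+ m)    -[1+ n ] = fromℤ-⊖ m (suc n)
    fromℤ-+ -[1+ m ] (+ n)    = trans (fromℤ-⊖ n (suc m)) (+-comm _ _)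
    fromℤ-+ -[1+ m ] -[1+ n ] = begin
      - (suc (suc (m ℕ.+ n)) · 1#)     ≡⟨ ≡.cong (λ k → - (k · 1#)) (ℕ.+-suc (suc m) n) ⟨
      - ((suc m ℕ.+ suc n) · 1#)       ≈⟨ -‿cong (×-homo-+ 1# (suc m) (suc n)) ⟩
      - (suc m · 1# + suc n · 1#)      ≈⟨ ⁻¹-∙-comm _ _ ⟨
      - (suc m · 1#) - suc n · 1#      ∎

    fromℤ-* : ∀ i j → fromℤ (i ℤ.* j) ≈ fromℤ i * fromℤ j
    fromℤ-* (+ m)    (+ n)    = trans (fromℤ-+◃ (m ℕ.* n)) (×1-homo-* m n)
    fromℤ-* (+ m)    -[1+ n ] = begin
      fromℤ (Sign.- ◃ m ℕ.* suc n)     ≈⟨ fromℤ--◃ (m ℕ.* suc n) ⟩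
      - ((m ℕ.* suc n) · 1#)           ≈⟨ -‿cong (×1-homo-* m (suc n)) ⟩
      - (m · 1# * (suc n · 1#))        ≈⟨ -‿distribʳ-* _ _ ⟩
      m · 1# * - (suc n · 1#)          ∎
    fromℤ-* -[1+ m ] (+ n)    = begin
      fromℤ (Sign.- ◃ suc m ℕ.* n)     ≈⟨ fromℤ--◃ (suc m ℕ.* n) ⟩
      - ((suc m ℕ.* n) · 1#)           ≈⟨ -‿cong (×1-homo-* (suc m) n) ⟩
      - (suc m · 1# * (n · 1#))        ≈⟨ -‿distribˡ-* _ _ ⟩
      - (suc m · 1#) * (n · 1#)        ∎
    fromℤ-* -[1+ m ] -[1+ n ] = begin
      (suc m ℕ.* suc n) · 1#               ≈⟨ ×1-homo-* (suc m) (suc n) ⟩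
      suc m · 1# * (suc n · 1#)            ≈⟨ ⁻¹-involutive _ ⟨
      - - (suc m · 1# * (suc n · 1#))      ≈⟨ -‿cong (-‿distribˡ-* _ _) ⟩
      - (- (suc m · 1#) * (suc n · 1#))    ≈⟨ -‿distribʳ-* _ _ ⟩
      - (suc m · 1#) * - (suc n · 1#)      ∎

    fromℤ-‿- : ∀ i → fromℤ (ℤ.- i) ≈ - fromℤ i
    fromℤ-‿- (+ zero)    = sym ε⁻¹≈ε
    fromℤ-‿- (+ (suc n)) = refl
    fromℤ-‿- -[1+ n ]    = sym (⁻¹-involutive _)

    ℤ-homomorphism : ℤ.+-*-rawRing -Raw-AlmostCommutative⟶ fromCommutativeRing R
    ℤ-homomorphism = record
      { ⟦_⟧    = fromℤ
      ; +-homo = fromℤ-+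
      ; *-homo = fromℤ-*
      ; -‿homo = fromℤ-‿-
      ; 0-homo = refl
      ; 1-homo = refl
      }

    -- Only a semi-decision: in a ring of positive characteristic distinct integers may have equal
    -- images.
    fromℤ-≟ : ∀ i j → Maybe (fromℤ i ≈ fromℤ j)
    fromℤ-≟ i j = map (λ i≡j → reflexive (≡.cong fromℤ i≡j)) (dec⇒maybe (i ℤ.≟ j))

  open import Algebra.Solver.Ring _ _ ℤ-homomorphism fromℤ-≟ public
    using (Polynomial; con; var; _:+_; _:*_; _:-_; :-_; _:=_; solve; prove)

-- Arithmetic of ordered fields and of probabilities.

module OrderedFieldProperties {k ℓ₁ ℓ₂} (K : OrderedField k ℓ₁ ℓ₂) where
  open OrderedField K
  open IntegerCoefficients commutativeRing
  open IsStrictTotalOrder isStrictTotalOrder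
    using (<-respˡ-≈; <-respʳ-≈) renaming (trans to <-trans; irrefl to <-irrefl)
  open import Algebra.Properties.Ring ring using (-‿distribʳ-*)
  open ≈-Reasoning setoid

  0<y-x⇒x<y : ∀ {x y} → 0# < y - x → x < y
  0<y-x⇒x<y {x} {y} 0<y-x =
    <-respˡ-≈ (+-identityˡ x)
      (<-respʳ-≈ (solve 2 (λ x y → (y :- x) :+ x := y) refl x y) (+-monoˡ-< x 0<y-x))

  x<y⇒0<y-x : ∀ {x y} → x < y → 0# < y - x
  x<y⇒0<y-x {x} {y} x<y = <-respˡ-≈ (-‿inverseʳ x) (+-monoˡ-< (- x) x<y)

  x≤y⇒0≤y-x : ∀ {x y} → x ≤ y → 0# ≤ y - x
  x≤y⇒0≤y-x (inj₁ x<y) = inj₁ (x<y⇒0<y-x x<y)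
  x≤y⇒0≤y-x {x} (inj₂ x≈y) = inj₂ (trans (sym (-‿inverseʳ x)) (+-congʳ x≈y))

  x<0⇒0<-x : ∀ {x} → x < 0# → 0# < - x
  x<0⇒0<-x x<0 = <-respʳ-≈ (+-identityˡ _) (x<y⇒0<y-x x<0)

  0<-x⇒x<0 : ∀ {x} → 0# < - x → x < 0#
  0<-x⇒x<0 0<-x = 0<y-x⇒x<y (<-respʳ-≈ (sym (+-identityˡ _)) 0<-x)

  0<x⇒-x<0 : ∀ {x} → 0# < x → - x < 0#
  0<x⇒-x<0 0<x = 0<-x⇒x<0 (<-respʳ-≈ (solve 1 (λ x → x := :- (:- x)) refl _) 0<x)

  <⇒≉ : ∀ {x y} → x < y → ¬ (x ≈ y)
  <⇒≉ x<y x≈y = <-irrefl x≈y x<y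

  0<⇒≉0 : ∀ {x} → 0# < x → ¬ (x ≈ 0#)
  0<⇒≉0 0<x x≈0 = <-irrefl (sym x≈0) 0<x

  ≤∧≉⇒< : ∀ {x y} → x ≤ y → ¬ (x ≈ y) → x < y
  ≤∧≉⇒< (inj₁ x<y) _   = x<y
  ≤∧≉⇒< (inj₂ x≈y) x≉y = contradiction x≈y x≉y

  ≤⇒≯ : ∀ {x y} → x ≤ y → ¬ (y < x)
  ≤⇒≯ (inj₁ x<y) y<x = <-irrefl refl (<-trans x<y y<x)
  ≤⇒≯ (inj₂ x≈y) y<x = <-irrefl (sym x≈y) y<x

  *-neg-neg : ∀ {x y} → x < 0# → y < 0# → 0# < x * y
  *-neg-neg {x} {y} x<0 y<0 =
    <-respʳ-≈ (solve 2 (λ x y → :- x :* :- y := x :* y) refl x y)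
      (*-pos (x<0⇒0<-x x<0) (x<0⇒0<-x y<0))

  -- A negative `1#` would still be positive, as the product `1# * 1#` of two negative elements.
  0<1 : 0# < 1#
  0<1 with compare 0# 1#
  ... | tri< 0<1 _ _ = 0<1
  ... | tri≈ _ 0≈1 _ = contradiction 0≈1 0≉1
  ... | tri> _ _ 1<0 = <-respʳ-≈ (*-identityˡ 1#) (*-neg-neg 1<0 1<0)

  +-pos-nonNeg : ∀ {x y} → 0# < x → 0# ≤ y → 0# < x + y
  +-pos-nonNeg {x} {y} 0<x (inj₁ 0<y) =
    <-trans 0<y (<-respˡ-≈ (+-identityˡ y) (+-monoˡ-< y 0<x))
  +-pos-nonNeg 0<x (inj₂ 0≈y) = <-respʳ-≈ (trans (sym (+-identityʳ _)) (+-congˡ 0≈y)) 0<x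

  +-pos : ∀ {x y} → 0# < x → 0# < y → 0# < x + y
  +-pos 0<x 0<y = +-pos-nonNeg 0<x (inj₁ 0<y)

  *-nonNeg : ∀ {x y} → 0# ≤ x → 0# ≤ y → 0# ≤ x * y
  *-nonNeg (inj₁ 0<x) (inj₁ 0<y) = inj₁ (*-pos 0<x 0<y)
  *-nonNeg (inj₁ _)   (inj₂ 0≈y) = inj₂ (sym (trans (*-congˡ (sym 0≈y)) (zeroʳ _)))
  *-nonNeg (inj₂ 0≈x) _          = inj₂ (sym (trans (*-congʳ (sym 0≈x)) (zeroˡ _)))

  *-pos-neg : ∀ {x y} → 0# < x → y < 0# → x * y < 0#
  *-pos-neg 0<x y<0 =
    0<-x⇒x<0 (<-respʳ-≈ (sym (-‿distribʳ-* _ _)) (*-pos 0<x (x<0⇒0<-x y<0)))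

  *-cancelʳ-≉0 : ∀ {x y} z → ¬ (z ≈ 0#) → x * z ≈ y * z → x ≈ y
  *-cancelʳ-≉0 {x} {y} z z≉0 xz≈yz = begin
    x               ≈⟨ *-identityʳ x ⟨
    x * 1#          ≈⟨ *-congˡ (⁻¹-inverseʳ z z≉0) ⟨
    x * (z * z ⁻¹)  ≈⟨ *-assoc x z _ ⟨
    x * z * z ⁻¹    ≈⟨ *-congʳ xz≈yz ⟩
    y * z * z ⁻¹    ≈⟨ *-assoc y z _ ⟩
    y * (z * z ⁻¹)  ≈⟨ *-congˡ (⁻¹-inverseʳ z z≉0) ⟩
    y * 1#          ≈⟨ *-identityʳ y ⟩
    y               ∎

  ≉0-* : ∀ {x y} → ¬ (x ≈ 0#) → ¬ (y ≈ 0#) → ¬ (x * y ≈ 0#)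
  ≉0-* {x} {y} x≉0 y≉0 xy≈0 = x≉0 (*-cancelʳ-≉0 y y≉0 (trans xy≈0 (sym (zeroˡ y))))

  *-cancelʳ-<-pos : ∀ {x y} z → 0# < z → x * z < y * z → x < y
  *-cancelʳ-<-pos {x} {y} z 0<z xz<yz with compare x y
  ... | tri< x<y _ _ = x<y
  ... | tri≈ _ x≈y _ = contradiction xz<yz (<-irrefl (*-congʳ x≈y))
  ... | tri> _ _ y<x = contradiction (<-trans xz<yz yz<xz) (<-irrefl refl)
    where
    yz<xz : y * z < x * z
    yz<xz = 0<y-x⇒x<y
      (<-respʳ-≈ (solve 3 (λ x y z → (x :- y) :* z := x :* z :- y :* z) refl x y z)
        (*-pos (x<y⇒0<y-x y<x) 0<z))

  x/y*y≈x : ∀ x {y} → ¬ (y ≈ 0#) → x / y * y ≈ x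
  x/y*y≈x x {y} y≉0 = begin
    x * y ⁻¹ * y    ≈⟨ *-assoc x _ y ⟩
    x * (y ⁻¹ * y)  ≈⟨ *-congˡ (trans (*-comm _ y) (⁻¹-inverseʳ y y≉0)) ⟩
    x * 1#          ≈⟨ *-identityʳ x ⟩
    x               ∎

  /-pos : ∀ {x y} → 0# < x → 0# < y → 0# < x / y
  /-pos {x} {y} 0<x 0<y = *-cancelʳ-<-pos y 0<y
    (<-respˡ-≈ (sym (zeroˡ y)) (<-respʳ-≈ (sym (x/y*y≈x x (0<⇒≉0 0<y))) 0<x))

  *-rotate : ∀ x y z → x * y * z ≈ y * z * x
  *-rotate x y z = trans (*-assoc x y z) (*-comm x _)

  x/d*[d*e]≈x*e : ∀ x {d} e → 0# < d → x / d * (d * e) ≈ x * e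
  x/d*[d*e]≈x*e x e 0<d = trans (sym (*-assoc _ _ e)) (*-congʳ (x/y*y≈x x (0<⇒≉0 0<d)))

  y/e*[d*e]≈y*d : ∀ y d {e} → 0# < e → y / e * (d * e) ≈ y * d
  y/e*[d*e]≈y*d y d 0<e = trans (*-congˡ (*-comm d _)) (x/d*[d*e]≈x*e y d 0<e)

  /-<-/ : ∀ {x y d e} → 0# < d → 0# < e → x * e < y * d → x / d < y / e
  /-<-/ {x} {y} {d} {e} 0<d 0<e xe<yd = *-cancelʳ-<-pos (d * e) (*-pos 0<d 0<e)
    (<-respˡ-≈ (sym (x/d*[d*e]≈x*e x e 0<d)) (<-respʳ-≈ (sym (y/e*[d*e]≈y*d y d 0<e)) xe<yd))

  /-≈-/ : ∀ {x y d e} → 0# < d → 0# < e → x * e ≈ y * d → x / d ≈ y / e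
  /-≈-/ {x} {y} {d} {e} 0<d 0<e xe≈yd = *-cancelʳ-≉0 (d * e) (0<⇒≉0 (*-pos 0<d 0<e))
    (trans (x/d*[d*e]≈x*e x e 0<d) (trans xe≈yd (sym (y/e*[d*e]≈y*d y d 0<e))))

  open Game K using (IsProbability)

  *-<1 : ∀ {x y} → x < 1# → 0# ≤ x → y ≤ 1# → x * y < 1#
  *-<1 {x} {y} x<1 0≤x y≤1 = 0<y-x⇒x<y
    (<-respʳ-≈
      (solve 2 (λ x y → (con 1ℤ :- x) :+ x :* (con 1ℤ :- y) := con 1ℤ :- x :* y) refl x y)
      (+-pos-nonNeg (x<y⇒0<y-x x<1) (*-nonNeg 0≤x (x≤y⇒0≤y-x y≤1))))

  *-≤1 : ∀ {x y} → IsProbability x → IsProbability y → x * y ≤ 1#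
  *-≤1 (0≤x , inj₁ x<1) (_ , y≤1) = inj₁ (*-<1 x<1 0≤x y≤1)
  *-≤1 (_ , inj₂ x≈1) (_ , inj₁ y<1) =
    inj₁ (<-respˡ-≈ (sym (trans (*-congʳ x≈1) (*-identityˡ _))) y<1)
  *-≤1 (_ , inj₂ x≈1) (_ , inj₂ y≈1) = inj₂ (trans (*-cong x≈1 y≈1) (*-identityˡ _))

  *-isProbability : ∀ {x y} → IsProbability x → IsProbability y → IsProbability (x * y)
  *-isProbability px py = *-nonNeg (proj₁ px) (proj₁ py) , *-≤1 px py

-- Best replies and stationary triples, apart from the game.

module StationaryTriples {k ℓ₁ ℓ₂} (K : OrderedField k ℓ₁ ℓ₂) where
  open OrderedField K
  open Game K using (IsProbability)
  open IntegerCoefficients commutativeRing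
  open OrderedFieldProperties K
  open IsStrictTotalOrder isStrictTotalOrder using (<-respˡ-≈; <-respʳ-≈)
  open import Algebra.Properties.AbelianGroup +-abelianGroup using (x∙y⁻¹≈ε⇒x≈y)
  open ≈-Reasoning setoid

  -- Here `m` stands for a player's ratio μᵢ, and `q`, `r` for the probabilities of the next two
  -- players along the cycle.
  slope : Carrier → Carrier → Carrier → Carrier
  slope m q r = m * (1# - q) - q * (1# - r)

  slope-cong : ∀ m {q q′ r r′} → q ≈ q′ → r ≈ r′ → slope m q r ≈ slope m q′ r′
  slope-cong m q≈q′ r≈r′ =
    +-cong (*-congˡ (+-congˡ (-‿cong q≈q′)))
           (-‿cong (*-cong q≈q′ (+-congˡ (-‿cong r≈r′))))

  slope-at-0 : ∀ m {q} r → q ≈ 0# → slope m q r ≈ m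
  slope-at-0 m r q≈0 = trans (slope-cong m q≈0 refl)
    (solve 2 (λ m r → m :* (con 1ℤ :- con 0ℤ) :- con 0ℤ :* (con 1ℤ :- r) := m) refl m r)

  slope-at-1 : ∀ m {q} r → q ≈ 1# → slope m q r ≈ - (1# - r)
  slope-at-1 m r q≈1 = trans (slope-cong m q≈1 refl)
    (solve 2 (λ m r →
       m :* (con 1ℤ :- con 1ℤ) :- con 1ℤ :* (con 1ℤ :- r) := :- (con 1ℤ :- r))
       refl m r)

  slope-at-1-neg : ∀ m {q r} → q ≈ 1# → r < 1# → slope m q r < 0#
  slope-at-1-neg m q≈1 r<1 = <-respˡ-≈ (sym (slope-at-1 m _ q≈1))
    (0<x⇒-x<0 (x<y⇒0<y-x r<1))

  slope-pos⇒≉1 : ∀ {m q r} → r ≤ 1# → 0# < slope m q r → ¬ (q ≈ 1#)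
  slope-pos⇒≉1 {m} {q} {r} r≤1 0<slope q≈1 = ≤⇒≯ (x≤y⇒0≤y-x r≤1)
    (0<-x⇒x<0 (<-respʳ-≈ (slope-at-1 m r q≈1) 0<slope))

  -- For `p` in the unit interval this says that `p` maximizes a linear function with the given
  -- slope; slope zero imposes nothing.
  BestReply : Carrier → Carrier → Carrier → Carrier → Set (ℓ₁ ⊔ ℓ₂)
  BestReply m p q r = (0# < slope m q r → p ≈ 1#) × (slope m q r < 0# → p ≈ 0#)

  -- Ratios and probabilities are separate arguments, so that `rotate` can permute them cyclically
  -- and each fact is proved for one player only.
  record Stationary (m₁ m₂ m₃ p q r : Carrier) : Set (ℓ₁ ⊔ ℓ₂) where
    field
      p-prob     : IsProbability p
      q-prob     : IsProbability q
      r-prob     : IsProbability r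
      notAllOne  : ¬ (p ≈ 1# × q ≈ 1# × r ≈ 1#)
      p-reply    : BestReply m₁ p q r
      q-reply    : BestReply m₂ q r p
      r-reply    : BestReply m₃ r p q

  open Stationary

  rotate : ∀ {m₁ m₂ m₃ p q r} → Stationary m₁ m₂ m₃ p q r → Stationary m₂ m₃ m₁ q r p
  rotate s = record
    { p-prob    = q-prob s
    ; q-prob    = r-prob s
    ; r-prob    = p-prob s
    ; notAllOne = λ (q≈1 , r≈1 , p≈1) → notAllOne s (p≈1 , q≈1 , r≈1)
    ; p-reply   = q-reply s
    ; q-reply   = r-reply s
    ; r-reply   = p-reply s
    }

  module _ {m₁ m₂ m₃ p q r : Carrier} (0<m₁ : 0# < m₁) (0<m₃ : 0# < m₃)
    (s : Stationary m₁ m₂ m₃ p q r) where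

    -- If `p` is 0, the third slope is `m₃`, which is positive, so `r` is 1. Then the second slope
    -- is `- (1# - p)`, which is negative, so `q` is 0. Then the first slope is `m₁`, which is
    -- positive and forces `p` to be 1.
    stationary⇒≉0 : ¬ (p ≈ 0#)
    stationary⇒≉0 p≈0 = 0≉1 (trans (sym p≈0) p≈1)
      where
      r≈1 : r ≈ 1#
      r≈1 = proj₁ (r-reply s) (<-respʳ-≈ (sym (slope-at-0 m₃ q p≈0)) 0<m₃)
      q≈0 : q ≈ 0#
      q≈0 = proj₂ (q-reply s) (slope-at-1-neg m₂ r≈1 (<-respˡ-≈ (sym p≈0) 0<1))
      p≈1 : p ≈ 1#
      p≈1 = proj₁ (p-reply s) (<-respʳ-≈ (sym (slope-at-0 m₁ r q≈0)) 0<m₁)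

  module _ {m₁ m₂ m₃ p q r : Carrier} (0<m₁ : 0# < m₁) (0<m₂ : 0# < m₂) (0<m₃ : 0# < m₃)
    (s : Stationary m₁ m₂ m₃ p q r) where

    -- Suppose `p` is 1. If `q` is below 1, the third slope is negative and `r` is 0, which is
    -- excluded by rotation. If `q` is 1, then `r` is below 1 by `notAllOne`, so the first slope is
    -- negative and `p` is 0.
    stationary⇒≉1 : ¬ (p ≈ 1#)
    stationary⇒≉1 p≈1 with q ≟ 1#
    ... | no q≉1 = stationary⇒≉0 0<m₃ 0<m₂ (rotate (rotate s))
      (proj₂ (r-reply s) (slope-at-1-neg m₃ p≈1 (≤∧≉⇒< (proj₂ (q-prob s)) q≉1)))
    ... | yes q≈1 = stationary⇒≉0 0<m₁ 0<m₃ s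
      (proj₂ (p-reply s) (slope-at-1-neg m₁ q≈1
        (≤∧≉⇒< (proj₂ (r-prob s)) (λ r≈1 → notAllOne s (p≈1 , q≈1 , r≈1)))))

    stationary⇒slope≈0 : slope m₁ q r ≈ 0#
    stationary⇒slope≈0 with compare (slope m₁ q r) 0#
    ... | tri< <0 _ _ = contradiction (proj₂ (p-reply s) <0) (stationary⇒≉0 0<m₁ 0<m₃ s)
    ... | tri≈ _ ≈0 _ = ≈0
    ... | tri> _ _ >0 = contradiction (proj₁ (p-reply s) >0) stationary⇒≉1

  -- Closed-form solution of the slope equations.

  share : Carrier → Carrier → Carrier → Carrier
  share m₁ m₂ m₃ = (m₁ * (1# + m₂ + m₂ * m₃)) / (1# + m₁ + m₁ * m₂)

  -- The equations slope ≈ 0 read m₁ (1 - q) ≈ q (1 - r) and cyclically; the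
  -- factors 1 - p, 1 - q, 1 - r cancel in their product.
  slopes≈0⇒product : ∀ {m₁ m₂ m₃ p q r} →
    ¬ (p ≈ 1#) → ¬ (q ≈ 1#) → ¬ (r ≈ 1#) →
    slope m₁ q r ≈ 0# → slope m₂ r p ≈ 0# → slope m₃ p q ≈ 0# →
    m₁ * m₂ * m₃ ≈ p * q * r
  slopes≈0⇒product {m₁} {m₂} {m₃} {p} {q} {r} p≉1 q≉1 r≉1 e₁ e₂ e₃ =
    *-cancelʳ-≉0 ((1# - p) * (1# - q) * (1# - r))
      (≉0-* (≉0-* (1-x≉0 p≉1) (1-x≉0 q≉1)) (1-x≉0 r≉1))
      (begin
        m₁ * m₂ * m₃ * ((1# - p) * (1# - q) * (1# - r))
          ≈⟨ solve 6 (λ m₁ m₂ m₃ x y z →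
               m₁ :* m₂ :* m₃ :* (x :* y :* z) := (m₁ :* y) :* (m₂ :* z) :* (m₃ :* x))
               refl m₁ m₂ m₃ (1# - p) (1# - q) (1# - r) ⟩
        (m₁ * (1# - q)) * (m₂ * (1# - r)) * (m₃ * (1# - p))
          ≈⟨ *-cong (*-cong (x-y≈0⇒x≈y e₁) (x-y≈0⇒x≈y e₂)) (x-y≈0⇒x≈y e₃) ⟩
        (q * (1# - r)) * (r * (1# - p)) * (p * (1# - q))
          ≈⟨ solve 6 (λ p q r x y z →
               (q :* z) :* (r :* x) :* (p :* y) := p :* q :* r :* (x :* y :* z))
               refl p q r (1# - p) (1# - q) (1# - r) ⟩
        p * q * r * ((1# - p) * (1# - q) * (1# - r)) ∎)
    where
    x-y≈0⇒x≈y : ∀ {x y} → x - y ≈ 0# → x ≈ y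
    x-y≈0⇒x≈y = x∙y⁻¹≈ε⇒x≈y _ _
    1-x≉0 : ∀ {x} → ¬ (x ≈ 1#) → ¬ (1# - x ≈ 0#)
    1-x≉0 x≉1 1-x≈0 = x≉1 (sym (x-y≈0⇒x≈y 1-x≈0))

  0<1+m₁+m₁m₂ : ∀ {m₁ m₂} → 0# < m₁ → 0# < m₂ → 0# < 1# + m₁ + m₁ * m₂
  0<1+m₁+m₁m₂ 0<m₁ 0<m₂ = +-pos (+-pos 0<1 0<m₁) (*-pos 0<m₁ 0<m₂)

  0<share : ∀ {m₁ m₂ m₃} → 0# < m₁ → 0# < m₂ → 0# < m₃ → 0# < share m₁ m₂ m₃
  0<share 0<m₁ 0<m₂ 0<m₃ = /-pos (*-pos 0<m₁ (0<1+m₁+m₁m₂ 0<m₂ 0<m₃)) (0<1+m₁+m₁m₂ 0<m₁ 0<m₂)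

  module _ {m₁ m₂ m₃ : Carrier} (0<m₁ : 0# < m₁) (0<m₂ : 0# < m₂) where

    private
      0<S : 0# < 1# + m₁ + m₁ * m₂
      0<S = 0<1+m₁+m₁m₂ 0<m₁ 0<m₂

    share-def : share m₁ m₂ m₃ * (1# + m₁ + m₁ * m₂) ≈ m₁ * (1# + m₂ + m₂ * m₃)
    share-def = x/y*y≈x _ (0<⇒≉0 0<S)

    -- Adding `1# + m₂` times the first slope to `q` times the second cancels the terms in `q * r`.
    -- Then `p` and `r` survive only in the product `p * q * r`, whose value is given, and a linear
    -- equation for `q` remains.
    slopes≈0⇒≈share : ∀ {p q r} → p * q * r ≈ m₁ * m₂ * m₃ →
      slope m₁ q r ≈ 0# → slope m₂ r p ≈ 0# → q ≈ share m₁ m₂ m₃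
    slopes≈0⇒≈share {p} {q} {r} pqr≈m e₁ e₂ = *-cancelʳ-≉0 S (0<⇒≉0 0<S) (begin
      q * S
        ≈⟨ solve 5 (λ m₁ m₂ p q r →
             q :* (con 1ℤ :+ m₁ :+ m₁ :* m₂) :=
             m₁ :+ m₁ :* m₂ :+ p :* q :* r
               :- (con 1ℤ :+ m₂) :* (m₁ :* (con 1ℤ :- q) :- q :* (con 1ℤ :- r))
               :- q :* (m₂ :* (con 1ℤ :- r) :- r :* (con 1ℤ :- p)))
             refl m₁ m₂ p q r ⟩
      m₁ + m₁ * m₂ + p * q * r - (1# + m₂) * slope m₁ q r - q * slope m₂ r p
        ≈⟨ +-cong (+-cong (+-congˡ pqr≈m) (-‿cong (*-congˡ e₁))) (-‿cong (*-congˡ e₂)) ⟩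
      m₁ + m₁ * m₂ + m₁ * m₂ * m₃ - (1# + m₂) * 0# - q * 0#
        ≈⟨ solve 4 (λ m₁ m₂ m₃ q →
             m₁ :+ m₁ :* m₂ :+ m₁ :* m₂ :* m₃ :- (con 1ℤ :+ m₂) :* con 0ℤ :- q :* con 0ℤ :=
             m₁ :* (con 1ℤ :+ m₂ :+ m₂ :* m₃))
             refl m₁ m₂ m₃ q ⟩
      m₁ * (1# + m₂ + m₂ * m₃)
        ≈⟨ share-def ⟨
      share m₁ m₂ m₃ * S ∎)
      where S = 1# + m₁ + m₁ * m₂

    -- Denominator minus numerator of `share` is `1# - m₁ * m₂ * m₃`, which is invariant under
    -- rotation of the ratios. This yields both the bound `share<1` and the cancellation in
    -- `slope-share`.
    1-share : (1# - share m₁ m₂ m₃) * (1# + m₁ + m₁ * m₂) ≈ 1# - m₁ * m₂ * m₃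
    1-share = begin
      (1# - x) * (1# + m₁ + m₁ * m₂)
        ≈⟨ solve 2 (λ x y → (con 1ℤ :- x) :* y := y :- x :* y) refl x _ ⟩
      (1# + m₁ + m₁ * m₂) - x * (1# + m₁ + m₁ * m₂)
        ≈⟨ +-congˡ (-‿cong share-def) ⟩
      (1# + m₁ + m₁ * m₂) - m₁ * (1# + m₂ + m₂ * m₃)
        ≈⟨ solve 3 (λ m₁ m₂ m₃ →
             (con 1ℤ :+ m₁ :+ m₁ :* m₂) :- m₁ :* (con 1ℤ :+ m₂ :+ m₂ :* m₃) :=
             con 1ℤ :- m₁ :* m₂ :* m₃)
             refl m₁ m₂ m₃ ⟩
      1# - m₁ * m₂ * m₃ ∎
      where x = share m₁ m₂ m₃

    share<1 : m₁ * m₂ * m₃ < 1# → share m₁ m₂ m₃ < 1#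
    share<1 m<1 = 0<y-x⇒x<y (*-cancelʳ-<-pos (1# + m₁ + m₁ * m₂) 0<S
      (<-respˡ-≈ (sym (zeroˡ _)) (<-respʳ-≈ (sym 1-share) (x<y⇒0<y-x m<1))))

  -- The denominator `T` of `y` is a factor of the numerator of `x`, so `x * S` equals `m₁ * T`.
  -- After multiplication by `S * T` both terms of the slope become `m₁ * T` times
  -- `1# - m₁ * m₂ * m₃`.
  slope-share : ∀ {m₁ m₂ m₃} → 0# < m₁ → 0# < m₂ → 0# < m₃ →
    slope m₁ (share m₁ m₂ m₃) (share m₂ m₃ m₁) ≈ 0#
  slope-share {m₁} {m₂} {m₃} 0<m₁ 0<m₂ 0<m₃ =
    *-cancelʳ-≉0 (S * T)
      (0<⇒≉0 (*-pos (0<1+m₁+m₁m₂ 0<m₁ 0<m₂) (0<1+m₁+m₁m₂ 0<m₂ 0<m₃)))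
      (begin
        slope m₁ x y * (S * T)
          ≈⟨ solve 5 (λ m₁ x y S T →
               (m₁ :* (con 1ℤ :- x) :- x :* (con 1ℤ :- y)) :* (S :* T) :=
               m₁ :* ((con 1ℤ :- x) :* S) :* T :- (x :* S) :* ((con 1ℤ :- y) :* T))
               refl m₁ x y S T ⟩
        m₁ * ((1# - x) * S) * T - (x * S) * ((1# - y) * T)
          ≈⟨ +-cong (*-congʳ (*-congˡ (1-share 0<m₁ 0<m₂)))
                    (-‿cong (*-cong (share-def 0<m₁ 0<m₂) (1-share 0<m₂ 0<m₃))) ⟩
        m₁ * (1# - m₁ * m₂ * m₃) * T - (m₁ * T) * (1# - m₂ * m₃ * m₁)
          ≈⟨ solve 4 (λ m₁ m₂ m₃ T →
               m₁ :* (con 1ℤ :- m₁ :* m₂ :* m₃) :* T :-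
               (m₁ :* T) :* (con 1ℤ :- m₂ :* m₃ :* m₁) :=
               con 0ℤ)
               refl m₁ m₂ m₃ T ⟩
        0#
          ≈⟨ zeroˡ _ ⟨
        0# * (S * T) ∎)
    where
    S = 1# + m₁ + m₁ * m₂
    T = 1# + m₂ + m₂ * m₃
    x = share m₁ m₂ m₃
    y = share m₂ m₃ m₁

  module _ {m₁ m₂ m₃ p q r : Carrier} (0<m₁ : 0# < m₁) (0<m₂ : 0# < m₂) (0<m₃ : 0# < m₃)
    (s : Stationary m₁ m₂ m₃ p q r) where

    stationary⇒product : m₁ * m₂ * m₃ ≈ p * q * r
    stationary⇒product = slopes≈0⇒product
      (stationary⇒≉1 0<m₁ 0<m₂ 0<m₃ s)
      (stationary⇒≉1 0<m₂ 0<m₃ 0<m₁ (rotate s))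
      (stationary⇒≉1 0<m₃ 0<m₁ 0<m₂ (rotate (rotate s)))
      (stationary⇒slope≈0 0<m₁ 0<m₂ 0<m₃ s)
      (stationary⇒slope≈0 0<m₂ 0<m₃ 0<m₁ (rotate s))
      (stationary⇒slope≈0 0<m₃ 0<m₁ 0<m₂ (rotate (rotate s)))

    stationary⇒≈share : q ≈ share m₁ m₂ m₃
    stationary⇒≈share = slopes≈0⇒≈share 0<m₁ 0<m₂ (sym stationary⇒product)
      (stationary⇒slope≈0 0<m₁ 0<m₂ 0<m₃ s)
      (stationary⇒slope≈0 0<m₂ 0<m₃ 0<m₁ (rotate s))

-- Single-entry updates and the cyclic order of the players.

updateAt-all : ∀ {a p n} {A : Set a} (P : A → Set p) {f : A → A} (xs : Vector A n) i →
  (∀ j → P (xs j)) → P (f (xs i)) → ∀ j → P (updateAt xs i f j)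
updateAt-all P xs zero    all Pfx zero    = Pfx
updateAt-all P xs zero    all Pfx (suc j) = all (suc j)
updateAt-all P xs (suc i) all Pfx zero    = all zero
updateAt-all P xs (suc i) all Pfx (suc j) = updateAt-all P (tail xs) i (all ∘ suc) Pfx j

next : Player → Player
next ① = ②
next ② = ③
next ③ = ①

next-≢ : ∀ i → next i ≢ i
next-≢ ① ()
next-≢ ② ()
next-≢ ③ ()

-- Effect of a deviation on the expected payoff.

module Payoffs {k ℓ₁ ℓ₂} (K : OrderedField k ℓ₁ ℓ₂) (u : Game.Payoff K) where
  open Game K
  open OrderedField K
  open IntegerCoefficients commutativeRing
  open OrderedFieldProperties K
  open StationaryTriples K
  open IsStrictTotalOrder isStrictTotalOrder using (<-respˡ-≈; <-respʳ-≈)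
    renaming (trans to <-trans; irrefl to <-irrefl)
  open ≈-Reasoning setoid

  infix 5 _[_≔_]
  _[_≔_] : Profile → Player → Carrier → Profile
  p [ i ≔ q ] = updateAt p i (const q)

  -- The numerator of the expected payoff over `Δ p`; the outcome `c` has first-turn probability 0
  -- and contributes nothing.
  weight : Profile → Position → Player → Carrier
  weight p v i =
    firstTurn p v (a ①) * u i (a ①) +
    firstTurn p v (a ②) * u i (a ②) +
    firstTurn p v (a ③) * u i (a ③)

  -- The probability of following the cycle from v until the first visit to vᵢ.
  reach : Profile → Position → Player → Carrier
  reach p ① ① = 1#
  reach p ① ② = p ①
  reach p ① ③ = p ① * p ②
  reach p ② ① = p ② * p ③
  reach p ② ② = 1#
  reach p ② ③ = p ②
  reach p ③ ① = p ③
  reach p ③ ② = p ① * p ③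
  reach p ③ ③ = 1#

  reach-self : ∀ p i → reach p i i ≡ 1#
  reach-self p ① = ≡.refl
  reach-self p ② = ≡.refl
  reach-self p ③ = ≡.refl

  -- The slope of player `i` multiplied by the denominator of μᵢ, which keeps the gain identity
  -- polynomial.
  incentive : Profile → Player → Carrier
  incentive p i =
    (1# - p (next i)) * (u i (a (next i)) - u i (a i)) -
    p (next i) * (1# - p (next (next i))) * (u i (a i) - u i (a (next (next i))))

  -- The difference of the payoffs after and before the deviation, with both denominators cleared.
  Gain : Profile → Position → Player → Carrier → Set ℓ₁
  Gain p v i q =
    weight (p [ i ≔ q ]) v i * Δ p ≈
    weight p v i * Δ (p [ i ≔ q ]) + (q - p i) * incentive p i * reach p v i

  -- Syntactic copies of the definitions above, for the ring solver.
  private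
    Poly : Set
    Poly = Polynomial 7

    :1 : Poly
    :1 = con 1ℤ

    :p :u : Vector Poly 3
    :p ① = var 0F
    :p ② = var 1F
    :p ③ = var 2F
    :u ① = var 3F
    :u ② = var 4F
    :u ③ = var 5F

    :q : Poly
    :q = var 6F

    :Δ : Vector Poly 3 → Poly
    :Δ p = :1 :- p ① :* p ② :* p ③

    :firstTurn : Vector Poly 3 → Position → Position → Poly
    :firstTurn p ① ① = :1 :- p ①
    :firstTurn p ① ② = p ① :* (:1 :- p ②)
    :firstTurn p ① ③ = p ① :* p ② :* (:1 :- p ③)
    :firstTurn p ② ① = p ② :* p ③ :* (:1 :- p ①)
    :firstTurn p ② ② = :1 :- p ②
    :firstTurn p ② ③ = p ② :* (:1 :- p ③)
    :firstTurn p ③ ① = p ③ :* (:1 :- p ①)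
    :firstTurn p ③ ② = p ① :* p ③ :* (:1 :- p ②)
    :firstTurn p ③ ③ = :1 :- p ③

    :weight : Vector Poly 3 → Position → Poly
    :weight p v =
      :firstTurn p v ① :* :u ① :+ :firstTurn p v ② :* :u ② :+ :firstTurn p v ③ :* :u ③

    :reach : Position → Player → Poly
    :reach ① ① = :1
    :reach ① ② = :p ①
    :reach ① ③ = :p ① :* :p ②
    :reach ② ① = :p ② :* :p ③
    :reach ② ② = :1
    :reach ② ③ = :p ②
    :reach ③ ① = :p ③
    :reach ③ ② = :p ① :* :p ③
    :reach ③ ③ = :1

    :incentive : Player → Poly
    :incentive i =
      (:1 :- :p (next i)) :* (:u (next i) :- :u i) :-
      :p (next i) :* (:1 :- :p (next (next i))) :* (:u i :- :u (next (next i)))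

    :lhs :rhs : Position → Player → Poly
    :lhs v i = :weight (updateAt :p i (const :q)) v :* :Δ :p
    :rhs v i =
      :weight :p v :* :Δ (updateAt :p i (const :q)) :+
      (:q :- :p i) :* :incentive i :* :reach v i

  -- For concrete `v` and `i` the functions `updateAt`, `next` and `firstTurn` compute, and each of
  -- the nine cases is a ring identity.
  gain : ∀ p v i q → Gain p v i q
  gain p v i q = byPosition v i
    where
    -- Only the payoffs of the deviating player occur, so seven variables suffice.
    env : Player → Vec Carrier 7
    env i = p ① ∷ p ② ∷ p ③ ∷ u i (a ①) ∷ u i (a ②) ∷ u i (a ③) ∷ q ∷ []

    byPosition : ∀ v i → Gain p v i q
    byPosition ① ① = prove (env ①) (:lhs ① ①) (:rhs ① ①) refl
    byPosition ① ② = prove (env ②) (:lhs ① ②) (:rhs ① ②) refl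
    byPosition ① ③ = prove (env ③) (:lhs ① ③) (:rhs ① ③) refl
    byPosition ② ① = prove (env ①) (:lhs ② ①) (:rhs ② ①) refl
    byPosition ② ② = prove (env ②) (:lhs ② ②) (:rhs ② ②) refl
    byPosition ② ③ = prove (env ③) (:lhs ② ③) (:rhs ② ③) refl
    byPosition ③ ① = prove (env ①) (:lhs ③ ①) (:rhs ③ ①) refl
    byPosition ③ ② = prove (env ②) (:lhs ③ ②) (:rhs ③ ②) refl
    byPosition ③ ③ = prove (env ③) (:lhs ③ ③) (:rhs ③ ③) refl

  -- Payoffs of finite and of surely infinite play.

  SurelyInfinite : Profile → Set ℓ₁
  SurelyInfinite p = ∀ i → p i ≈ 1#

  distribution-finite : ∀ p → ¬ SurelyInfinite p →
    ∀ v x → distribution p v x ≡ firstTurn p v x / Δ p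
  distribution-finite p p≉1 v x =
    ≡.cong (if_then surelyInfinite x else firstTurn p v x / Δ p)
      (dec-false (all? (λ i → p i ≟ 1#)) p≉1)

  distribution-infinite : ∀ p → SurelyInfinite p →
    ∀ v x → distribution p v x ≡ surelyInfinite x
  distribution-infinite p p≈1 v x =
    ≡.cong (if_then surelyInfinite x else firstTurn p v x / Δ p)
      (dec-true (all? (λ i → p i ≟ 1#)) p≈1)

  expectation : (Outcome → Carrier) → Player → Carrier
  expectation d i =
    d (a ①) * u i (a ①) + d (a ②) * u i (a ②) + d (a ③) * u i (a ③) + d c * u i c

  expectation-cong : ∀ {d d′} i → (∀ x → d x ≡ d′ x) → expectation d i ≈ expectation d′ i
  expectation-cong i d≗d′ =
    +-cong (+-cong (+-cong (term (a ①)) (term (a ②))) (term (a ③))) (term c)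
    where term = λ x → *-congʳ {u i x} (reflexive (d≗d′ x))

  expectedPayoff-finite : ∀ p → ¬ SurelyInfinite p → ∀ v i →
    expectedPayoff u p v i ≈ weight p v i / Δ p
  expectedPayoff-finite p p≉1 v i = trans
    (expectation-cong i (distribution-finite p p≉1 v))
    (solve 8 (λ f₁ f₂ f₃ d u₁ u₂ u₃ u₄ →
       f₁ :* d :* u₁ :+ f₂ :* d :* u₂ :+ f₃ :* d :* u₃ :+ con 0ℤ :* d :* u₄ :=
       (f₁ :* u₁ :+ f₂ :* u₂ :+ f₃ :* u₃) :* d)
       refl (firstTurn p v (a ①)) (firstTurn p v (a ②)) (firstTurn p v (a ③)) (Δ p ⁻¹)
       (u i (a ①)) (u i (a ②)) (u i (a ③)) (u i c))

  expectedPayoff-infinite : ∀ p → SurelyInfinite p → ∀ v i → expectedPayoff u p v i ≈ u i c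
  expectedPayoff-infinite p p≈1 v i = trans
    (expectation-cong i (distribution-infinite p p≈1 v))
    (solve 4 (λ u₁ u₂ u₃ u₄ →
       con 0ℤ :* u₁ :+ con 0ℤ :* u₂ :+ con 0ℤ :* u₃ :+ con 1ℤ :* u₄ := u₄)
       refl (u i (a ①)) (u i (a ②)) (u i (a ③)) (u i c))

  -- Equality is decidable, so some particular player has probability below 1; the other factors are
  -- at most 1, and the product stays below 1.
  Δ-pos : ∀ {p} → (∀ i → IsProbability (p i)) → ¬ SurelyInfinite p → 0# < Δ p
  Δ-pos {p} prob p≉1 = x<y⇒0<y-x (product<1 (¬∀⟶∃¬ 3 _ (λ i → p i ≟ 1#) p≉1))
    where
    p<1 : ∀ i → ¬ (p i ≈ 1#) → p i < 1#
    p<1 i = ≤∧≉⇒< (proj₂ (prob i))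
    p₁p₂ : IsProbability (p ① * p ②)
    p₁p₂ = *-isProbability (prob ①) (prob ②)
    product<1 : ∃ (λ i → ¬ (p i ≈ 1#)) → p ① * p ② * p ③ < 1#
    product<1 (① , p₁≉1) =
      *-<1 (*-<1 (p<1 ① p₁≉1) (proj₁ (prob ①)) (proj₂ (prob ②))) (proj₁ p₁p₂) (proj₂ (prob ③))
    product<1 (② , p₂≉1) =
      *-<1 (<-respˡ-≈ (*-comm _ _) (*-<1 (p<1 ② p₂≉1) (proj₁ (prob ②)) (proj₂ (prob ①))))
        (proj₁ p₁p₂) (proj₂ (prob ③))
    product<1 (③ , p₃≉1) =
      <-respˡ-≈ (*-comm _ _) (*-<1 (p<1 ③ p₃≉1) (proj₁ (prob ③)) (proj₂ p₁p₂))

  -- The entry at `next i` survives a deviation of player `i`.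
  deviation-finite : ∀ {p q} i → ¬ (p (next i) ≈ 1#) → ¬ SurelyInfinite (p [ i ≔ q ])
  deviation-finite {p} i pₙ≉1 p′≈1 = pₙ≉1
    (trans (reflexive (≡.sym (updateAt-minimal (next i) i p (next-≢ i)))) (p′≈1 (next i)))

  module _ {p : Profile} {i : Player} {q : Carrier}
    (p-prob : ∀ j → IsProbability (p j)) (q-prob : IsProbability q)
    (p≉1 : ¬ SurelyInfinite p) (p′≉1 : ¬ SurelyInfinite (p [ i ≔ q ])) where

    private
      p′ : Profile
      p′ = p [ i ≔ q ]

      0<Δp : 0# < Δ p
      0<Δp = Δ-pos p-prob p≉1

      0<Δp′ : 0# < Δ p′
      0<Δp′ = Δ-pos (updateAt-all IsProbability p i p-prob q-prob) p′≉1

    -- The play starts at the deviator's own position, where `reach` is `1#`. From another position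
    -- `reach` may be 0, and the gain with it.
    deviation-profitable : 0# < (q - p i) * incentive p i →
      expectedPayoff u p i i < expectedPayoff u p′ i i
    deviation-profitable 0<gain =
      <-respˡ-≈ (sym (expectedPayoff-finite p p≉1 i i))
        (<-respʳ-≈ (sym (expectedPayoff-finite p′ p′≉1 i i))
          (/-<-/ 0<Δp 0<Δp′ (0<y-x⇒x<y (<-respʳ-≈ difference 0<gain))))
      where
      N = weight p i i * Δ p′
      G = (q - p i) * incentive p i
      difference : G ≈ weight p′ i i * Δ p - N
      difference = begin
        G                           ≈⟨ solve 2 (λ g n → g := n :+ g :* con 1ℤ :- n) refl G N ⟩
        N + G * 1# - N              ≡⟨ ≡.cong (λ w → N + G * w - N) (reach-self p i) ⟨
        N + G * reach p i i - N     ≈⟨ +-congʳ (gain p i i q) ⟨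
        weight p′ i i * Δ p - N     ∎

    deviation-neutral : incentive p i ≈ 0# → ∀ v →
      expectedPayoff u p v i ≈ expectedPayoff u p′ v i
    deviation-neutral incentive≈0 v = begin
      expectedPayoff u p v i   ≈⟨ expectedPayoff-finite p p≉1 v i ⟩
      weight p v i / Δ p       ≈⟨ /-≈-/ 0<Δp 0<Δp′ (sym numerators) ⟩
      weight p′ v i / Δ p′     ≈⟨ expectedPayoff-finite p′ p′≉1 v i ⟨
      expectedPayoff u p′ v i  ∎
      where
      numerators : weight p′ v i * Δ p ≈ weight p v i * Δ p′
      numerators = begin
        weight p′ v i * Δ p
          ≈⟨ gain p v i q ⟩
        weight p v i * Δ p′ + (q - p i) * incentive p i * reach p v i
          ≈⟨ +-congˡ (*-congʳ (*-congˡ incentive≈0)) ⟩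
        weight p v i * Δ p′ + (q - p i) * 0# * reach p v i
          ≈⟨ solve 3 (λ n d w → n :+ d :* con 0ℤ :* w := n) refl _ _ _ ⟩
        weight p v i * Δ p′ ∎

  -- Here `Δ p` is 0 and payoffs are not given by `weight`, so the case is treated directly: from v₁
  -- player 1 leaves at once and gets `u ① (a ①)` instead of `u ① c`.
  UNE⇒¬SurelyInfinite : u ① c < u ① (a ①) → ∀ p → IsUNE u p → ¬ SurelyInfinite p
  UNE⇒¬SurelyInfinite c<a p (prob , une) p≈1 = une ① ① 0# (inj₂ refl , inj₁ 0<1)
    (<-respˡ-≈ (sym (expectedPayoff-infinite p p≈1 ① ①)) (<-respʳ-≈ (sym leave) c<a))
    where
    p′ : Profile
    p′ = p [ ① ≔ 0# ]
    Δp′≉0 : ¬ (Δ p′ ≈ 0#)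
    Δp′≉0 Δp′≈0 = 0≉1 (trans (sym Δp′≈0)
      (solve 2 (λ q r → con 1ℤ :- con 0ℤ :* q :* r := con 1ℤ) refl (p ②) (p ③)))
    leave : expectedPayoff u p′ ① ① ≈ u ① (a ①)
    leave = begin
      expectedPayoff u p′ ① ①
        ≈⟨ expectedPayoff-finite p′ (λ p′≈1 → 0≉1 (p′≈1 ①)) ① ① ⟩
      weight p′ ① ① / Δ p′
        ≈⟨ *-congʳ (solve 5 (λ q r u₁ u₂ u₃ →
             (con 1ℤ :- con 0ℤ) :* u₁ :+
             con 0ℤ :* (con 1ℤ :- q) :* u₂ :+
             con 0ℤ :* q :* (con 1ℤ :- r) :* u₃ :=
             u₁ :* (con 1ℤ :- con 0ℤ :* q :* r))
             refl (p ②) (p ③) _ _ _) ⟩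
      u ① (a ①) * Δ p′ / Δ p′
        ≈⟨ *-assoc _ _ _ ⟩
      u ① (a ①) * (Δ p′ / Δ p′)
        ≈⟨ *-congˡ (⁻¹-inverseʳ (Δ p′) Δp′≉0) ⟩
      u ① (a ①) * 1#
        ≈⟨ *-identityʳ _ ⟩
      u ① (a ①) ∎

  -- At ①, ② and ③ this unfolds to `μ₁ u`, `μ₂ u` and `μ₃ u`, so uniform statements specialize
  -- without conversion.
  μ : Player → Carrier
  μ i = (u i (a (next i)) - u i (a i)) / (u i (a i) - u i (a (next (next i))))

  slopeAt : Profile → Player → Carrier
  slopeAt p i = slope (μ i) (p (next i)) (p (next (next i)))

  -- Payoffs with the cyclic ranking of the outcomes.

  module Ranked
    (worst  : ∀ i → u i c < u i (a (next (next i))))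
    (middle : ∀ i → u i (a (next (next i))) < u i (a i))
    (best   : ∀ i → u i (a i) < u i (a (next i)))
    where

    0<loss : ∀ i → 0# < u i (a i) - u i (a (next (next i)))
    0<loss i = x<y⇒0<y-x (middle i)

    0<μ : ∀ i → 0# < μ i
    0<μ i = /-pos (x<y⇒0<y-x (best i)) (0<loss i)

    incentive≈loss*slope : ∀ p i →
      incentive p i ≈ (u i (a i) - u i (a (next (next i)))) * slopeAt p i
    incentive≈loss*slope p i = begin
      (1# - q) * (u i (a (next i)) - u i (a i)) - q * (1# - r) * y
        ≈⟨ +-congʳ (*-congˡ (x/y*y≈x _ (0<⇒≉0 (0<loss i)))) ⟨
      (1# - q) * (μ i * y) - q * (1# - r) * y
        ≈⟨ solve 4 (λ q r y m →
             (con 1ℤ :- q) :* (m :* y) :- q :* (con 1ℤ :- r) :* y :=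
             y :* (m :* (con 1ℤ :- q) :- q :* (con 1ℤ :- r)))
             refl q r y (μ i) ⟩
      y * slopeAt p i ∎
      where
      q = p (next i)
      r = p (next (next i))
      y = u i (a i) - u i (a (next (next i)))

    -- Necessity: an equilibrium is stationary, hence given by the formula.

    module _ {p : Profile} (une : IsUNE u p) where

      private
        prob : ∀ i → IsProbability (p i)
        prob = proj₁ une

        p≉1 : ¬ SurelyInfinite p
        p≉1 = UNE⇒¬SurelyInfinite (<-trans (worst ①) (middle ①)) p une

        not-profitable : ∀ i q → IsProbability q → ¬ SurelyInfinite (p [ i ≔ q ]) →
          ¬ (0# < (q - p i) * incentive p i)
        not-profitable i q q-prob p′≉1 0<gain =
          proj₂ une i i q q-prob (deviation-profitable prob q-prob p≉1 p′≉1 0<gain)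

      UNE⇒BestReply : ∀ i → BestReply (μ i) (p i) (p (next i)) (p (next (next i)))
      UNE⇒BestReply i = rise , fall
        where
        rise : 0# < slopeAt p i → p i ≈ 1#
        rise 0<slope with proj₂ (prob i)
        ... | inj₂ pᵢ≈1 = pᵢ≈1
        ... | inj₁ pᵢ<1 = contradiction
          (*-pos (x<y⇒0<y-x pᵢ<1)
            (<-respʳ-≈ (sym (incentive≈loss*slope p i)) (*-pos (0<loss i) 0<slope)))
          -- A positive slope keeps `p (next i)` away from 1, so moving `p i` up to 1 does not make
          -- the play surely infinite.
          (not-profitable i 1# (inj₁ 0<1 , inj₂ refl)
            (deviation-finite i (slope-pos⇒≉1 (proj₂ (prob _)) 0<slope)))

        fall : slopeAt p i < 0# → p i ≈ 0#
        fall slope<0 with proj₁ (prob i)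
        ... | inj₂ 0≈pᵢ = sym 0≈pᵢ
        ... | inj₁ 0<pᵢ = contradiction
          (*-neg-neg (<-respˡ-≈ (sym (+-identityˡ _)) (0<x⇒-x<0 0<pᵢ))
            (<-respˡ-≈ (sym (incentive≈loss*slope p i)) (*-pos-neg (0<loss i) slope<0)))
          (not-profitable i 0# (inj₂ refl , inj₁ 0<1)
            (λ p′≈1 → 0≉1 (trans (reflexive (≡.sym (updateAt-updates i p))) (p′≈1 i))))

      UNE⇒Stationary : Stationary (μ ①) (μ ②) (μ ③) (p ①) (p ②) (p ③)
      UNE⇒Stationary = record
        { p-prob    = prob ①
        ; q-prob    = prob ②
        ; r-prob    = prob ③
        ; notAllOne = λ (p₁≈1 , p₂≈1 , p₃≈1) →
            p≉1 λ { ① → p₁≈1 ; ② → p₂≈1 ; ③ → p₃≈1 }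
        ; p-reply   = UNE⇒BestReply ①
        ; q-reply   = UNE⇒BestReply ②
        ; r-reply   = UNE⇒BestReply ③
        }

      -- The product of the ratios equals that of the probabilities, which is 1 minus the positive
      -- `Δ p`.
      UNE⇒μ-product<1 : μ ① * μ ② * μ ③ < 1#
      UNE⇒μ-product<1 = <-respˡ-≈
        (sym (stationary⇒product (0<μ ①) (0<μ ②) (0<μ ③) UNE⇒Stationary))
        (0<y-x⇒x<y (Δ-pos prob p≉1))

      UNE⇒≈equilibrium : ∀ i → p i ≈ equilibrium u i
      -- The share built from `μ i` onwards belongs to player `next i`, hence the shifted indices
      -- and the double rotation for ①.
      UNE⇒≈equilibrium ① =
        stationary⇒≈share (0<μ ③) (0<μ ①) (0<μ ②) (rotate (rotate UNE⇒Stationary))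
      UNE⇒≈equilibrium ② = stationary⇒≈share (0<μ ①) (0<μ ②) (0<μ ③) UNE⇒Stationary
      UNE⇒≈equilibrium ③ = stationary⇒≈share (0<μ ②) (0<μ ③) (0<μ ①) (rotate UNE⇒Stationary)

    -- Sufficiency: the formula gives an equilibrium.

    module _ (product<1 : μ ① * μ ② * μ ③ < 1#) where

      private
        product<1′ : ∀ i → μ i * μ (next i) * μ (next (next i)) < 1#
        product<1′ ① = product<1
        product<1′ ② = <-respˡ-≈ (*-rotate _ _ _) product<1
        product<1′ ③ = <-respˡ-≈ (*-rotate _ _ _) (product<1′ ②)

        shareAt : Player → Carrier
        shareAt i = share (μ i) (μ (next i)) (μ (next (next i)))

        0<shareAt : ∀ i → 0# < shareAt i
        0<shareAt i = 0<share (0<μ i) (0<μ (next i)) (0<μ (next (next i)))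

        shareAt<1 : ∀ i → shareAt i < 1#
        shareAt<1 i = share<1 (0<μ i) (0<μ (next i)) (product<1′ i)

        equilibrium<1 : ∀ i → equilibrium u i < 1#
        equilibrium<1 ① = shareAt<1 ③
        equilibrium<1 ② = shareAt<1 ①
        equilibrium<1 ③ = shareAt<1 ②

        0<equilibrium : ∀ i → 0# < equilibrium u i
        0<equilibrium ① = 0<shareAt ③
        0<equilibrium ② = 0<shareAt ①
        0<equilibrium ③ = 0<shareAt ②

        slopeAt-equilibrium : ∀ i → slopeAt (equilibrium u) i ≈ 0#
        slopeAt-equilibrium ① = slope-share (0<μ ①) (0<μ ②) (0<μ ③)
        slopeAt-equilibrium ② = slope-share (0<μ ②) (0<μ ③) (0<μ ①)
        slopeAt-equilibrium ③ = slope-share (0<μ ③) (0<μ ①) (0<μ ②)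

        prob : ∀ i → IsProbability (equilibrium u i)
        prob i = inj₁ (0<equilibrium i) , inj₁ (equilibrium<1 i)

        e≉1 : ¬ SurelyInfinite (equilibrium u)
        e≉1 e≈1 = <⇒≉ (equilibrium<1 ①) (e≈1 ①)

      -- All entries are below 1, so after any deviation the next player's entry still prevents
      -- surely infinite play. As all slopes vanish, the deviator's payoff is unchanged from every
      -- position, and irreflexivity of `_<_` concludes.
      equilibrium-isUNE : IsUNE u (equilibrium u)
      equilibrium-isUNE = prob , λ v i q q-prob → <-irrefl
        (deviation-neutral prob q-prob e≉1 (deviation-finite i (<⇒≉ (equilibrium<1 (next i))))
          (trans (incentive≈loss*slope (equilibrium u) i)
            (trans (*-congˡ (slopeAt-equilibrium i)) (zeroʳ _)))
          v)

-- The dichotomy according to the product of the ratios.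

proposition5 :
    ∀ {k ℓ₁ ℓ₂} (K : OrderedField k ℓ₁ ℓ₂) →
    let open OrderedField K
        open Game K
    in
    (u : Payoff) →
    u ① c < u ① (a ③) → u ① (a ③) < u ① (a ①) → u ① (a ①) < u ① (a ②) →
    u ② c < u ② (a ①) → u ② (a ①) < u ② (a ②) → u ② (a ②) < u ② (a ③) →
    u ③ c < u ③ (a ②) → u ③ (a ②) < u ③ (a ③) → u ③ (a ③) < u ③ (a ①) →
    (1# ≤ μ₁ u * μ₂ u * μ₃ u → ¬ (∃ λ p → IsUNE u p)) ×
    (μ₁ u * μ₂ u * μ₃ u < 1# →
      IsUNE u (equilibrium u) ×
      (∀ p → IsUNE u p → ∀ i → p i ≈ equilibrium u i))
proposition5 K u c<a₃ a₃<a₁ a₁<a₂ c<a₁ a₁<a₂′ a₂<a₃ c<a₂ a₂<a₃′ a₃<a₁′ =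
  (λ 1≤μ (p , une) → ≤⇒≯ 1≤μ (UNE⇒μ-product<1 une)) ,
  (λ μ<1 → equilibrium-isUNE μ<1 , λ p une → UNE⇒≈equilibrium une)
  where
  open OrderedField K using (_<_)
  open OrderedFieldProperties K
  open Payoffs K u
  worst : ∀ i → u i c < u i (a (next (next i)))
  worst ① = c<a₃
  worst ② = c<a₁
  worst ③ = c<a₂
  middle : ∀ i → u i (a (next (next i))) < u i (a i)
  middle ① = a₃<a₁
  middle ② = a₁<a₂′
  middle ③ = a₂<a₃′
  best : ∀ i → u i (a i) < u i (a (next i))
  best ① = a₁<a₂
  best ② = a₂<a₃
  best ③ = a₃<a₁′
  open Ranked worst middle best
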